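{- Let $D$ be a strongly connected digraph with $n$ vertices. (a) If $D$ is an oriented graph with minimum in-degree at least $2$, then $\ell_s(D)\ge (n/4)^{1/3}-1$. (b) If $D$ is a digraph with minimum in-degree at least $3$, then $\ell_s(D)\ge (n/4)^{1/3}-1$.
   Context: Digraphs are finite, with no loops and no parallel arcs (directed 2-cycles are allowed). An oriented graph is a digraph with no directed 2-cycle. The in-degree $d^-(v)$ of a vertex $v$ is the number of its in-neighbors, i.e. vertices $u$ such that $uv$ is an arc. A digraph is strongly connected if for every pair $x,y$ of vertices there are directed paths from $x$ to $y$ and from $y$ to $x$. A subdigraph $T$ of a digraph $D$ is an out-tree if $T$ is an oriented tree with only one vertex of in-degree zero (called the root); if moreover $V(T)=V(D)$, then $T$ is called an out-branching of $D$. The leaves of $T$ are its vertices of out-degree zero in $T$. $\ell_s(D)$ denotes the maximum possible number of leaves in an out-branching of $D$, with $\ell_s(D)=0$ if $D$ has no out-branching. -}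

module Defs where

open import Level using (0ℓ)
open import Data.Bool.Base using (true; false)
open import Data.Nat.Base using (ℕ; zero; suc; _≤_; z≤n; s≤s)
import Data.Nat.Properties as ℕ
open import Data.Fin.Base using (Fin; zero; suc)
open import Data.Fin.Properties using (_≟_; any?; all?; injective⇒≤)
open import Data.Fin.Subset using (Subset; _∈_)
open import Data.Fin.Subset.Properties using (_∈?_)
open import Data.Vec.Base using (Vec; []; _∷_; lookup)
open import Data.List.Base as List
  using (List; []; _∷_; [_]; _∷ʳ_; length; map; filter; allFin; cartesianProductWith)
open import Data.List.Extrema.Nat using (max; xs≤max; argmax-sel)
open import Data.List.Membership.Propositional using (find; lose) renaming (_∈_ to _∈ₗ_)
open import Data.List.Membership.Propositional.Properties
  using (∈-allFin; ∈-cartesianProductWith⁺; ∈-filter⁺; ∈-filter⁻; ∈-map⁺; ∈-map⁻; ∈-lookup)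
open import Data.List.Relation.Unary.All as All using ()
import Data.List.Relation.Unary.Any as Any
open Any using (here; there)
open import Data.List.Relation.Unary.AllPairs using (_∷_)
open import Data.List.Relation.Unary.Linked using (Linked; linked?)
open import Data.List.Relation.Unary.Unique.Propositional using (Unique)
import Data.List.Relation.Unary.Unique.DecPropositional as DecUnique
open import Data.Product.Base using (∃; _×_; _,_; proj₁; proj₂)
open import Data.Product using (∃!)
open import Data.Sum.Base using (_⊎_; inj₁; inj₂; [_,_]′)
open import Function.Base using (id; _∘_)
open import Relation.Binary.Core using (Rel; _⇒_)
open import Relation.Binary.Definitions using (Asymmetric; Irreflexive; Decidable)
open import Relation.Binary.Construct.Closure.ReflexiveTransitive using (Star; ε; _◅_; _◅◅_)
open import Relation.Binary.PropositionalEquality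
  using (_≡_; refl; sym; cong; subst)
open import Relation.Nullary using (¬_; Dec; contradiction)
open import Relation.Nullary.Decidable using (map′; _×-dec_; _⊎-dec_; _→-dec_; ¬?)

-- A set of arcs on the vertex set Fin n, given by the out-neighbourhood of
-- each vertex.
ArcSet : ℕ → Set
ArcSet n = Vec (Subset n) n

module _ {n : ℕ} where

  Arc : ArcSet n → Rel (Fin n) 0ℓ
  Arc A u v = v ∈ lookup A u

  arc? : (A : ArcSet n) → Decidable (Arc A)
  arc? A u v = v ∈? lookup A u

  inDegree : ArcSet n → Fin n → ℕ
  inDegree A v = length (filter (λ u → arc? A u v) (allFin n))

  outDegree : ArcSet n → Fin n → ℕ
  outDegree A u = length (filter (arc? A u) (allFin n))

  leaves : ArcSet n → List (Fin n)
  leaves A = filter (λ v → outDegree A v ℕ.≟ 0) (allFin n)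

  Adjacent : ArcSet n → Rel (Fin n) 0ℓ
  Adjacent A u v = Arc A u v ⊎ Arc A v u

  Connected : Rel (Fin n) 0ℓ → Set
  Connected R = ∀ u v → Star R u v

  -- The closed walk x, xs, x is a cycle of length at least 3.
  IsCycle : Rel (Fin n) 0ℓ → Fin n → List (Fin n) → Set
  IsCycle R x xs = 2 ≤ length xs × Unique (x ∷ xs) × Linked R (x ∷ xs ∷ʳ x)

  Acyclic : Rel (Fin n) 0ℓ → Set
  Acyclic R = ¬ (∃ λ x → ∃ λ xs → IsCycle R x xs)

  -- Asymmetry excludes directed 2-cycles (and loops), so that each edge of the
  -- underlying undirected tree comes from exactly one arc.
  record IsOrientedTree (T : ArcSet n) : Set where
    constructor orientedTree
    field
      oriented  : Asymmetric (Arc T)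
      connected : Connected (Adjacent T)
      acyclic   : Acyclic (Adjacent T)

  record IsOutTree (T : ArcSet n) : Set where
    constructor outTree
    field
      isOrientedTree : IsOrientedTree T
      uniqueRoot     : ∃! _≡_ λ r → inDegree T r ≡ 0

record Digraph (n : ℕ) : Set where
  field
    arcs     : ArcSet n
    loopless : Irreflexive _≡_ (Arc arcs)

open Digraph public

module _ {n : ℕ} where

  IsOriented : Digraph n → Set
  IsOriented D = Asymmetric (Arc (arcs D))

  StronglyConnected : Digraph n → Set
  StronglyConnected D = Connected (Arc (arcs D))

  MinInDegreeAtLeast : ℕ → Digraph n → Set
  MinInDegreeAtLeast k D = ∀ v → k ≤ inDegree (arcs D) v

  -- T is an arc set on all of Fin n, so it is automatically spanning.
  record IsOutBranching (D : Digraph n) (T : ArcSet n) : Set where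
    constructor outBranching
    field
      subdigraph : Arc T ⇒ Arc (arcs D)
      isOutTree  : IsOutTree T

module _ {n : ℕ} {R : Rel (Fin n) 0ℓ} (R? : Decidable R) where

  private
    -- Reachability by walks whose interior vertices all lie in a given list.
    Via : List (Fin n) → Rel (Fin n) 0ℓ
    Via []       x y = x ≡ y ⊎ R x y
    Via (v ∷ vs) x y = Via vs x y ⊎ (Via vs x v × Via vs v y)

    via? : ∀ vs → Decidable (Via vs)
    via? []       x y = (x ≟ y) ⊎-dec R? x y
    via? (v ∷ vs) x y = via? vs x y ⊎-dec (via? vs x v ×-dec via? vs v y)

    via⇒star : ∀ vs {x y} → Via vs x y → Star R x y
    via⇒star []       (inj₁ refl)    = ε
    via⇒star []       (inj₂ r)       = r ◅ ε
    via⇒star (v ∷ vs) (inj₁ p)       = via⇒star vs p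
    via⇒star (v ∷ vs) (inj₂ (p , q)) = via⇒star vs p ◅◅ via⇒star vs q

    base : ∀ vs {x y} → x ≡ y ⊎ R x y → Via vs x y
    base []       p = p
    base (v ∷ vs) p = inj₁ (base vs p)

    join : ∀ {vs x v y} → v ∈ₗ vs → Via vs x v → Via vs v y → Via vs x y
    join (here refl) p q = inj₂ ([ id , proj₁ ]′ p , [ id , proj₂ ]′ q)
    join (there m) (inj₁ p)       (inj₁ q)       = inj₁ (join m p q)
    join (there m) (inj₁ p)       (inj₂ (q , r)) = inj₂ (join m p q , r)
    join (there m) (inj₂ (p , q)) (inj₁ r)       = inj₂ (p , join m q r)
    join (there m) (inj₂ (p , _)) (inj₂ (_ , s)) = inj₂ (p , s)

    star⇒via : ∀ {x y} → Star R x y → Via (allFin n) x y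
    star⇒via ε       = base (allFin n) (inj₁ refl)
    star⇒via (r ◅ s) = join (∈-allFin _) (base (allFin n) (inj₂ r)) (star⇒via s)

  star? : Decidable (Star R)
  star? x y = map′ (via⇒star (allFin n)) star⇒via (via? (allFin n) x y)

  connected? : Dec (Connected R)
  connected? = all? λ u → all? (star? u)

  private
    isCycle? : ∀ x xs → Dec (IsCycle R x xs)
    isCycle? x xs =
      (2 ℕ.≤? length xs) ×-dec DecUnique.unique? _≟_ (x ∷ xs)
                         ×-dec linked? R? (x ∷ xs ∷ʳ x)

    lists≤ : ℕ → List (List (Fin n))
    lists≤ zero    = [ [] ]
    lists≤ (suc k) = [] ∷ cartesianProductWith _∷_ (allFin n) (lists≤ k)

    ∈-lists≤ : ∀ k {xs} → length xs ≤ k → xs ∈ₗ lists≤ k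
    ∈-lists≤ zero    {[]}     _         = here refl
    ∈-lists≤ (suc k) {[]}     _         = here refl
    ∈-lists≤ (suc k) {x ∷ xs} (s≤s len) =
      there (∈-cartesianProductWith⁺ _∷_ (∈-allFin x) (∈-lists≤ k len))

    lookup-injective : ∀ {xs : List (Fin n)} → Unique xs → ∀ {i j} →
                       List.lookup xs i ≡ List.lookup xs j → i ≡ j
    lookup-injective (_ ∷ _)  {zero}  {zero}  _  = refl
    lookup-injective (px ∷ _) {zero}  {suc j} eq =
      contradiction eq (All.lookup px (∈-lookup j))
    lookup-injective (px ∷ _) {suc i} {zero}  eq =
      contradiction (sym eq) (All.lookup px (∈-lookup i))
    lookup-injective (_ ∷ u)  {suc i} {suc j} eq = cong suc (lookup-injective u eq)

    cycle-bound : ∀ {x xs} → IsCycle R x xs → length xs ≤ n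
    cycle-bound (_ , u , _) = ℕ.≤-trans (ℕ.n≤1+n _) (injective⇒≤ (lookup-injective u))

  acyclic? : Dec (Acyclic R)
  acyclic? = ¬? (any? λ x →
    map′ (λ p → let xs , _ , c = find p in xs , c)
         (λ (xs , c) → lose (∈-lists≤ n (cycle-bound c)) c)
         (Any.any? (isCycle? x) (lists≤ n)))

module _ {n : ℕ} where

  private
    asymmetric? : (A : ArcSet n) → Dec (Asymmetric (Arc A))
    asymmetric? A = map′ (λ f {x} {y} → f x y) (λ f x y → f {x} {y})
      (all? λ x → all? λ y → arc? A x y →-dec ¬? (arc? A y x))

    adjacent? : (A : ArcSet n) → Decidable (Adjacent A)
    adjacent? A u v = arc? A u v ⊎-dec arc? A v u

    uniqueRoot? : (T : ArcSet n) → Dec (∃! _≡_ λ r → inDegree T r ≡ 0)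
    uniqueRoot? T = any? λ r → (inDegree T r ℕ.≟ 0) ×-dec
      map′ (λ f {y} → f y) (λ f y → f {y})
        (all? λ y → (inDegree T y ℕ.≟ 0) →-dec (r ≟ y))

  isOutTree? : (T : ArcSet n) → Dec (IsOutTree T)
  isOutTree? T =
    map′ (λ (o , c , a , r) → outTree (orientedTree (λ {x} {y} → o {x} {y}) c a) r)
         (λ (outTree (orientedTree o c a) r) → (λ {x} {y} → o {x} {y}) , c , a , r)
         (asymmetric? T ×-dec connected? (adjacent? T)
           ×-dec acyclic? (adjacent? T) ×-dec uniqueRoot? T)

  isOutBranching? : (D : Digraph n) (T : ArcSet n) → Dec (IsOutBranching D T)
  isOutBranching? D T =
    map′ (λ (s , t) → outBranching (λ {x} {y} → s x y) t)
         (λ (outBranching s t) → (λ x y → s {x} {y}) , t)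
         ((all? λ x → all? λ y → arc? T x y →-dec arc? (arcs D) x y)
           ×-dec isOutTree? T)

vecs : {A : Set} → List A → (k : ℕ) → List (Vec A k)
vecs xs zero    = [ [] ]
vecs xs (suc k) = cartesianProductWith _∷_ xs (vecs xs k)

∈-vecs : {A : Set} {xs : List A} → (∀ a → a ∈ₗ xs) →
         ∀ {k} (v : Vec A k) → v ∈ₗ vecs xs k
∈-vecs all []      = here refl
∈-vecs all (a ∷ v) = ∈-cartesianProductWith⁺ _∷_ (all a) (∈-vecs all v)

arcSets : ∀ n → List (ArcSet n)
arcSets n = vecs (vecs (true ∷ false ∷ []) n) n

∈-arcSets : ∀ {n} (A : ArcSet n) → A ∈ₗ arcSets n
∈-arcSets = ∈-vecs (∈-vecs λ { true → here refl ; false → there (here refl) })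

module _ {n : ℕ} (D : Digraph n) where

  outBranchings : List (ArcSet n)
  outBranchings = filter (isOutBranching? D) (arcSets n)

  -- The maximum number of leaves of an out-branching; 0 if there is none.
  ℓₛ : ℕ
  ℓₛ = max 0 (map (length ∘ leaves) outBranchings)

  leaves≤ℓₛ : ∀ {T} → IsOutBranching D T → length (leaves T) ≤ ℓₛ
  leaves≤ℓₛ {T} b = All.lookup (xs≤max 0 (map (length ∘ leaves) outBranchings))
    (∈-map⁺ (length ∘ leaves) (∈-filter⁺ (isOutBranching? D) (∈-arcSets T) b))

  ℓₛ-attained : ∀ {T} → IsOutBranching D T →
                ∃ λ T′ → IsOutBranching D T′ × length (leaves T′) ≡ ℓₛ
  ℓₛ-attained {T} b with argmax-sel id 0 (map (length ∘ leaves) outBranchings)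
  ... | inj₁ ℓ≡0 = T , b ,
    ℕ.≤-antisym (leaves≤ℓₛ b) (subst (_≤ length (leaves T)) (sym ℓ≡0) z≤n)
  ... | inj₂ ℓ∈ =
    let T′ , T′∈ , eq = ∈-map⁻ (length ∘ leaves) ℓ∈
    in  T′ , proj₂ (∈-filter⁻ (isOutBranching? D) {xs = arcSets n} T′∈) , sym eq

  ℓₛ≡0 : (∀ T → ¬ IsOutBranching D T) → ℓₛ ≡ 0
  ℓₛ≡0 none with argmax-sel id 0 (map (length ∘ leaves) outBranchings)
  ... | inj₁ ℓ≡0 = ℓ≡0
  ... | inj₂ ℓ∈ =
    let T , T∈ , _ = ∈-map⁻ (length ∘ leaves) ℓ∈
    in  contradiction (proj₂ (∈-filter⁻ (isOutBranching? D) {xs = arcSets n} T∈)) (none T)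

{-# OPTIONS --safe #-}

-- Take an out-branching T with the largest number ℓ of leaves; every out-tree
-- extends to an out-branching with at least as many leaves, so none has more
-- than ℓ.  T has at most ℓ branching vertices, so it splits into at most 2 ℓ paths
-- z t → … → z 1 → z 0 on which all vertices but z 0 have out-degree 1, and it is
-- enough to bound t linearly in ℓ.  By the degree condition each interior z j has
-- an in-neighbour w j other than z (j ± 1); by maximality w j is not one of the
-- vertices z (j + 2), …, z t.  Let b be the first j for which w j is no descendant
-- of z t.  Below z b every vertex can hang from its w j, in a tree rooted at z 0;
-- above z b the same holds once z b itself hangs from w b.
--
-- In such a run x m → … → x 0 each x k may hang from its w or from x (k + 1), and
-- the choice is free as long as no two consecutive vertices choose x (k + 1).
-- Each vertex chosen twice saves a leaf, and a 3-colouring of the conflicts finds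
-- enough of them: m ≤ 4 ℓ + 1.  Altogether n ≤ 2 ℓ (8 ℓ + 5) ≤ 4 (ℓ + 1)³.
module Submission where

open import Defs
open import Data.Empty using (⊥; ⊥-elim)
open import Data.Fin.Base using (Fin; zero; suc; fromℕ<)
open import Data.Fin.Induction using (spo-noetherian)
open import Data.Fin.Properties using (_≟_; any?; all?)
open import Data.List.Base
  using (List; []; _∷_; length; map; filter; upTo; _++_; allFin; concatMap; _∷ʳ_)
import Data.List.Membership.DecPropositional as DecMembership
open import Data.List.Membership.Propositional using (_∈_; _∉_; lose)
open import Data.List.Membership.Propositional.Properties
open import Data.List.Properties
  using (length-++; length-map; length-upTo; filter-none; length-tabulate)
open import Data.List.Relation.Binary.Subset.Propositional using (_⊆_)
open import Data.List.Relation.Unary.All as All using (All; []; _∷_)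
open import Data.List.Relation.Unary.AllPairs using ([]; _∷_)
open import Data.List.Relation.Unary.Any using (here; there)
open import Data.List.Relation.Unary.Linked as Linked using (Linked; []; [-]; _∷_)
open import Data.List.Relation.Unary.Unique.Propositional using (Unique)
open import Data.List.Relation.Unary.Unique.Propositional.Properties
  using (filter⁺; upTo⁺; allFin⁺)
open import Data.Nat.Base
  using (ℕ; zero; suc; pred; _+_; _*_; _∸_; _^_; _⊓_; _≤_; _<_; z≤n; s≤s)
open import Data.Nat.Induction using (<-rec)
open import Data.Nat.Properties as ℕ hiding (_≟_)
open import Data.Nat.Tactic.RingSolver using (solve-∀)
open import Data.Product.Base using (∃; ∃₂; _×_; _,_; proj₁; proj₂)
open import Data.Sum.Base using (_⊎_; inj₁; inj₂; swap)
open import Data.Unit.Base using (tt)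
open import Data.Vec.Base using (tabulate; lookup)
open import Data.Vec.Properties using (lookup∘tabulate; lookup⇒[]=; []=⇒lookup)
open import Function.Base using (_∘_; id)
open import Induction.WellFounded using (Acc; acc)
open import Level using (0ℓ)
open import Relation.Binary.Construct.Closure.ReflexiveTransitive
  using (Star; ε; _◅_; _◅◅_; reverse)
import Relation.Binary.Construct.On as On
open import Relation.Binary.Definitions using (tri<; tri≈; tri>)
open import Relation.Binary.PropositionalEquality
open import Relation.Nullary using (¬_; Dec; yes; no; contradiction)
open import Relation.Nullary.Decidable
  using (_×-dec_; _⊎-dec_; ¬?; from-yes; does; dec-true; decidable-stable)
open import Relation.Unary using (Pred; Decidable; U)

-- Lists and colourings

private variable
  A : Set
  xs ys : List A

unique⊆⇒length≤ : Unique xs → xs ⊆ ys → length xs ≤ length ys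
unique⊆⇒length≤ {xs = []}     _        _  = z≤n
unique⊆⇒length≤ {xs = x ∷ xs} (x∉ ∷ u) xs⊆ with ∈-∃++ (xs⊆ (here refl))
... | as , bs , refl = begin
  suc (length xs)               ≤⟨ s≤s (unique⊆⇒length≤ u rest⊆) ⟩
  suc (length (as ++ bs))       ≡⟨ cong suc (length-++ as) ⟩
  suc (length as + length bs)   ≡⟨ +-suc (length as) (length bs) ⟨
  length as + length (x ∷ bs)   ≡⟨ length-++ as ⟨
  length (as ++ x ∷ bs)         ∎
  where
  open ≤-Reasoning
  rest⊆ : xs ⊆ as ++ bs
  rest⊆ y∈ with ∈-++⁻ as (xs⊆ (there y∈))
  ... | inj₁ y∈as         = ∈-++⁺ˡ y∈as
  ... | inj₂ (here refl)  = contradiction refl (All.lookup x∉ y∈)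
  ... | inj₂ (there y∈bs) = ∈-++⁺ʳ as y∈bs

module _ {P : Pred A 0ℓ} (P? : Decidable P) where

  length-filter-¬ : ∀ xs → length (filter P? xs) + length (filter (¬? ∘ P?) xs) ≡ length xs
  length-filter-¬ []       = refl
  length-filter-¬ (x ∷ xs) with P? x
  ... | yes _ = cong suc (length-filter-¬ xs)
  ... | no  _ = trans (+-suc _ _) (cong suc (length-filter-¬ xs))

  search-below : ∀ n {f : ℕ → A} → (∀ {k} → k < n → ¬ P (f k)) ⊎
                 (∃ λ b → b < n × P (f b) × ∀ {k} → k < b → ¬ P (f k))
  search-below zero = inj₁ λ ()
  search-below (suc n) {f} with search-below n {f}
  ... | inj₂ (b , b<n , Pb , least) = inj₂ (b , m<n⇒m<1+n b<n , Pb , least)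
  ... | inj₁ none with P? (f n)
  ...   | yes Pn = inj₂ (n , n<1+n n , Pn , none)
  ...   | no ¬Pn = inj₁ none′
    where
    none′ : ∀ {k} → k < suc n → ¬ P (f k)
    none′ k<1+n with m<1+n⇒m<n∨m≡n k<1+n
    ... | inj₁ k<n  = none k<n
    ... | inj₂ refl = ¬Pn

third-colour : ∀ a b → ∃ λ (c : Fin 3) → c ≢ a × c ≢ b
third-colour = from-yes (all? λ (a : Fin 3) → all? λ b → any? λ c → ¬? (c ≟ a) ×-dec ¬? (c ≟ b))

-- Greedy colouring in increasing order: `suc j` conflicts only with `j` and `g j`, which are
-- coloured already, so at most two of the three colours are forbidden.
three-colouring : (g : ℕ → ℕ) → (∀ j → g j ≤ j) → ∀ m → ∃ λ (c : ℕ → Fin 3) →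
                  ∀ {j} → j < m → c (suc j) ≢ c j × c (suc j) ≢ c (g j)
three-colouring g g≤ zero    = (λ _ → zero) , λ ()
three-colouring g g≤ (suc m) with three-colouring g g≤ m
... | c , proper = c′ , proper′
  where
  new = third-colour (c m) (c (g m))

  c′ : ℕ → Fin 3
  c′ i with i ℕ.≟ suc m
  ... | yes _ = proj₁ new
  ... | no  _ = c i

  c′-old : ∀ {i} → i ≤ m → c′ i ≡ c i
  c′-old {i} i≤m with i ℕ.≟ suc m
  ... | yes refl = contradiction i≤m 1+n≰n
  ... | no  _    = refl

  c′-new : c′ (suc m) ≡ proj₁ new
  c′-new with suc m ℕ.≟ suc m
  ... | yes _  = refl
  ... | no  ≢  = contradiction refl ≢

  proper′ : ∀ {j} → j < suc m → c′ (suc j) ≢ c′ j × c′ (suc j) ≢ c′ (g j)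
  proper′ {j} j<1+m with m<1+n⇒m<n∨m≡n j<1+m
  ... | inj₁ j<m
    rewrite c′-old j<m | c′-old (<⇒≤ j<m) | c′-old (≤-trans (g≤ j) (<⇒≤ j<m)) = proper j<m
  ... | inj₂ refl
    rewrite c′-new | c′-old (≤-refl {m}) | c′-old (g≤ m) = proj₂ new

unique-map : ∀ {B : Set} {f : A → B} → (∀ {a b} → a ∈ xs → b ∈ xs → f a ≡ f b → a ≡ b) →
             Unique xs → Unique (map f xs)
unique-map         injective []       = []
unique-map {f = f} injective (x∉ ∷ u) =
  All.tabulate (λ y∈ fx≡y → let z , z∈ , y≡fz = ∈-map⁻ f y∈ in
    All.lookup x∉ z∈ (injective (here refl) (there z∈) (trans fx≡y y≡fz)))
  ∷ unique-map (λ a∈ b∈ → injective (there a∈) (there b∈)) u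

length-concatMap≤ : ∀ {B : Set} (f : A → List B) {b} → (∀ a → length (f a) ≤ b) →
                    ∀ xs → length (concatMap f xs) ≤ length xs * b
length-concatMap≤ f f≤ []       = z≤n
length-concatMap≤ f f≤ (x ∷ xs) =
  subst (_≤ _) (sym (length-++ (f x))) (+-mono-≤ (f≤ x) (length-concatMap≤ f f≤ xs))

-- Arborescences given by parent functions

module _ {n : ℕ} where

  -- A witness that iterating `p` from `v` reaches `r`, which certifies acyclicity. Asking for
  -- `v ≢ r` ends it at the first visit to `r`, so that its height is determined by `v`.
  data Climb (p : Fin n → Fin n) (r : Fin n) : Fin n → Set where
    stop : Climb p r r
    up   : ∀ {v} → v ≢ r → Climb p r (p v) → Climb p r v

  module _ {p : Fin n → Fin n} {r : Fin n} where

    climb-up : ∀ {v} → Climb p r (p v) → Climb p r v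
    climb-up {v} c with v ≟ r
    ... | yes refl = stop
    ... | no  v≢r  = up v≢r c

    -- Until it reaches `r` the climb stays in `W`, where `p` and `q` agree.
    climb-transfer : ∀ {W : Pred (Fin n) 0ℓ} {q} → (∀ {v} → W v → v ≢ r → W (p v)) →
                     (∀ {v} → W v → q v ≡ p v) → ∀ {v} → W v → Climb p r v → Climb q r v
    climb-transfer closed q≡p w stop       = stop
    climb-transfer {q = q} closed q≡p w (up v≢r c) =
      up v≢r (subst (Climb q r) (sym (q≡p w)) (climb-transfer closed q≡p (closed w v≢r) c))

    height : ∀ {v} → Climb p r v → ℕ
    height stop     = 0
    height (up _ c) = suc (height c)

    height-unique : ∀ {v} (c d : Climb p r v) → height c ≡ height d
    height-unique stop       stop       = refl
    height-unique stop       (up v≢r _) = contradiction refl v≢r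
    height-unique (up v≢r _) stop       = contradiction refl v≢r
    height-unique (up _ c)   (up _ d)   = cong suc (height-unique c d)

  _[_≔_] : (Fin n → Fin n) → Fin n → Fin n → Fin n → Fin n
  (p [ a ≔ y ]) v with v ≟ a
  ... | yes _ = y
  ... | no  _ = p v

  module _ (p : Fin n → Fin n) (a y : Fin n) where

    ≔-same : (p [ a ≔ y ]) a ≡ y
    ≔-same with a ≟ a
    ... | yes _ = refl
    ... | no  ≢ = contradiction refl ≢

    ≔-other : ∀ {v} → v ≢ a → (p [ a ≔ y ]) v ≡ p v
    ≔-other {v} v≢a with v ≟ a
    ... | yes v≡a = contradiction v≡a v≢a
    ... | no  _   = refl

  -- Below p r a u: the climb from u to r passes through a.
  data Below (p : Fin n → Fin n) (r a : Fin n) : Fin n → Set where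
    here  : Below p r a a
    below : ∀ {u} → u ≢ r → Below p r a (p u) → Below p r a u

  module _ {p : Fin n → Fin n} {r : Fin n} where

    below? : ∀ a {u} → Climb p r u → Dec (Below p r a u)
    below? a {u} c with a ≟ u
    below? a {u} c          | yes refl = yes here
    below? a {u} stop       | no a≢u = no λ { here → a≢u refl ; (below r≢r _) → r≢r refl }
    below? a {u} (up u≢r c) | no a≢u with below? a c
    ... | yes b = yes (below u≢r b)
    ... | no ¬b = no λ { here → a≢u refl ; (below _ b) → ¬b b }

    -- The climb from `y` avoids `a`, so it survives the change; any other climb either avoids `a`
    -- too or arrives at `a` and continues from `y`.
    reroute : ∀ {a y} → ¬ Below p r a y → (∀ v → Climb p r v) → ∀ v → Climb (p [ a ≔ y ]) r v
    reroute {a} {y} ¬below climbs v = go (climbs v)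
      where
      q = p [ a ≔ y ]

      avoiding : ∀ {v} → ¬ Below p r a v → Climb q r v
      avoiding ¬b = climb-transfer {W = λ v → ¬ Below p r a v}
        (λ ¬b v≢r → ¬b ∘ below v≢r) (λ ¬b → ≔-other p a y λ { refl → ¬b here }) ¬b (climbs _)

      go : ∀ {v} → Climb p r v → Climb q r v
      go stop = stop
      go {v} (up v≢r c) with v ≟ a
      ... | yes refl = climb-up (subst (Climb q r) (sym (≔-same p a y)) (avoiding ¬below))
      ... | no  v≢a  = climb-up (subst (Climb q r) (sym (≔-other p a y v≢a)) (go c))

-- Growing an arborescence without losing leaves

module Arborescences {n : ℕ} (R : Fin n → Fin n → Set) where

  -- An out-tree with vertex set `W`. The function `parent` is total; outside `W` and at the root
  -- its values are arbitrary.
  record Arborescence (W : Pred (Fin n) 0ℓ) : Set where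
    field
      root   : Fin n
      parent : Fin n → Fin n
      root∈  : W root
      closed : ∀ {v} → W v → v ≢ root → W (parent v)
      arc    : ∀ {v} → W v → v ≢ root → R (parent v) v
      climb  : ∀ {v} → W v → Climb parent root v

    Leaf : Pred (Fin n) 0ℓ
    Leaf v = W v × (∀ {u} → W u → u ≢ root → parent u ≢ v)

  open Arborescence

  HasLeaves : ∀ {W} → Arborescence W → ℕ → Set
  HasLeaves A k = ∃ λ L → Unique L × All (Leaf A) L × k ≤ length L

  -- When the new vertex v is hung below a leaf u, it replaces u as a leaf.
  absorb-arc : ∀ {W k u v} (A : Arborescence W) → Decidable W → HasLeaves A k → W u → R u v →
               ∃ λ W′ → Decidable W′ × (∀ {w} → W w → W′ w) × W′ v ×
               ∃ λ (A′ : Arborescence W′) → HasLeaves A′ k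
  absorb-arc {W} {k} {u} {v} A W? leaves u∈W u→v with W? v
  ... | yes v∈W = W , W? , id , v∈W , A , leaves
  ... | no  v∉W = W′ , (λ w → W? w ⊎-dec w ≟ v) , inj₁ , inj₂ refl , A′ , leaves′ leaves
    where
    W′ : Pred (Fin n) 0ℓ
    W′ w = W w ⊎ w ≡ v

    ≢v : ∀ {w} → W w → w ≢ v
    ≢v w∈W refl = v∉W w∈W

    q = parent A [ v ≔ u ]

    q-new : q v ≡ u
    q-new = ≔-same (parent A) v u

    q-old : ∀ {w} → W w → q w ≡ parent A w
    q-old w∈W = ≔-other (parent A) v u (≢v w∈W)

    old-climb : ∀ {w} → W w → Climb q (root A) w
    old-climb w∈W = climb-transfer (closed A) q-old w∈W (climb A w∈W)

    A′ : Arborescence W′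
    A′ .root   = root A
    A′ .parent = q
    A′ .root∈  = inj₁ (root∈ A)
    A′ .closed (inj₁ w)    w≢r = inj₁ (subst W (sym (q-old w)) (closed A w w≢r))
    A′ .closed (inj₂ refl) _   = inj₁ (subst W (sym q-new) u∈W)
    A′ .arc {w} (inj₁ w∈)  w≢r = subst (λ z → R z w) (sym (q-old w∈)) (arc A w∈ w≢r)
    A′ .arc (inj₂ refl)    _   = subst (λ z → R z v) (sym q-new) u→v
    A′ .climb (inj₁ w)         = old-climb w
    A′ .climb (inj₂ refl)      = climb-up (subst (Climb q (root A)) (sym q-new) (old-climb u∈W))

    leaf-v : Leaf A′ v
    leaf-v = inj₂ refl , λ
      { (inj₁ w)    w≢r eq → v∉W (subst W (trans (sym (q-old w)) eq) (closed A w w≢r))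
      ; (inj₂ refl) _   eq → ≢v u∈W (trans (sym q-new) eq) }

    leaf-old : ∀ {w} → w ≢ u → Leaf A w → Leaf A′ w
    leaf-old w≢u (w , childless) = inj₁ w , λ
      { (inj₁ x)    x≢r eq → childless x x≢r (trans (sym (q-old x)) eq)
      ; (inj₂ refl) _   eq → w≢u (trans (sym eq) q-new) }

    leaves′ : HasLeaves A k → HasLeaves A′ k
    leaves′ (L , unique , leaf , k≤) = v ∷ L∖u ,
      All.tabulate (λ w∈ v≡w → ≢v (proj₁ (All.lookup leaf (proj₁ (∈L∖u⁻ w∈)))) (sym v≡w))
        ∷ filter⁺ ≢u? unique ,
      leaf-v ∷ All.tabulate (λ w∈ →
        let w∈L , w≢u = ∈L∖u⁻ w∈ in leaf-old w≢u (All.lookup leaf w∈L)) ,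
      ≤-trans k≤ (unique⊆⇒length≤ unique L⊆)
      where
      ≢u? = λ w → ¬? (w ≟ u)
      L∖u = filter ≢u? L

      ∈L∖u⁻ : ∀ {w} → w ∈ L∖u → w ∈ L × w ≢ u
      ∈L∖u⁻ = ∈-filter⁻ ≢u? {xs = L}

      L⊆ : L ⊆ u ∷ L∖u
      L⊆ {w} w∈L with w ≟ u
      ... | yes w≡u = here w≡u
      ... | no  w≢u = there (∈-filter⁺ ≢u? w∈L w≢u)

  Absorb : Pred (Fin n) 0ℓ → ℕ → Pred (Fin n) 0ℓ → Set₁
  Absorb W k X = ∃ λ W′ → Decidable W′ × (∀ {w} → W w → W′ w) × (∀ {w} → X w → W′ w) ×
                 ∃ λ (A′ : Arborescence W′) → HasLeaves A′ k

  absorb-walk : ∀ {W k u v} (A : Arborescence W) → Decidable W → HasLeaves A k →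
                W u → Star R u v → Absorb W k (_≡ v)
  absorb-walk A W? leaves u∈ ε = _ , W? , id , (λ { refl → u∈ }) , A , leaves
  absorb-walk A W? leaves u∈ (u→w ◅ w→*v) =
    let W₁ , W₁? , ⊆₁ , w∈ , A₁ , leaves₁ = absorb-arc A W? leaves u∈ u→w
        W₂ , W₂? , ⊆₂ , v∈ , A₂ , leaves₂ = absorb-walk A₁ W₁? leaves₁ w∈ w→*v
    in  W₂ , W₂? , ⊆₂ ∘ ⊆₁ , v∈ , A₂ , leaves₂

  absorb-list : ∀ {W k u} → (∀ v → Star R u v) → (A : Arborescence W) → Decidable W →
                HasLeaves A k → W u → ∀ vs → Absorb W k (_∈ vs)
  absorb-list walk A W? leaves u∈ [] = _ , W? , id , (λ ()) , A , leaves
  absorb-list walk A W? leaves u∈ (v ∷ vs) =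
    let W₁ , W₁? , ⊆₁ , v∈ , A₁ , leaves₁ = absorb-walk A W? leaves u∈ (walk v)
        W₂ , W₂? , ⊆₂ , vs∈ , A₂ , leaves₂ = absorb-list walk A₁ W₁? leaves₁ (⊆₁ u∈) vs
    in  W₂ , W₂? , ⊆₂ ∘ ⊆₁ , (λ { (here w≡v) → ⊆₂ (v∈ w≡v) ; (there w∈) → vs∈ w∈ }) , A₂ , leaves₂

  Spanning : Set
  Spanning = Arborescence U

  -- Walks from the root lead to every vertex, and absorbing them arc by arc never lowers the number
  -- of leaves.
  spanning : ∀ {W k} → Connected R → (A : Arborescence W) → Decidable W → HasLeaves A k →
             ∃ λ (T : Spanning) → HasLeaves T k
  spanning connected A W? leaves =
    let W₁ , _ , _ , all∈ , A₁ , L , unique , leaf , k≤ =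
          absorb-list (connected (root A)) A W? leaves (root∈ A) (allFin n)
        full : ∀ v → W₁ v
        full v = all∈ (∈-allFin v)
    in  record { root = root A₁ ; parent = parent A₁ ; root∈ = tt ; closed = λ _ _ → tt
               ; arc = λ {v} _ → arc A₁ (full v) ; climb = λ {v} _ → climb A₁ (full v) } ,
        L , unique , All.map (λ (_ , childless) → tt , λ {u} _ → childless (full u)) leaf , k≤

  spanning-exists : Connected R → Fin n → Spanning
  spanning-exists connected r = proj₁ (spanning connected single (_≟ r) ([] , [] , [] , z≤n))
    where
    single : Arborescence (_≡ r)
    single = record { root = r ; parent = id ; root∈ = refl
                    ; closed = λ { refl r≢r → contradiction refl r≢r }
                    ; arc = λ { refl r≢r → contradiction refl r≢r } ; climb = λ { refl → stop } }

  -- Trees on all decidable vertex sets are included, so that partial trees can be compared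
  -- directly; for connected `R`, `spanning` reduces this to spanning trees.
  LeavesAtMost : ℕ → Set₁
  LeavesAtMost ℓ = ∀ {W k} → Decidable W → (A : Arborescence W) → HasLeaves A k → k ≤ ℓ

-- Runs of back arcs

module _ {n : ℕ} {R : Fin n → Fin n → Set} where
  open Arborescences R
  open Arborescence

  -- The path `x (m - 1) → … → x 0` lies outside the tree `A`, and the `u k` are alternative
  -- parents. Each choice of parents made in `Shifted` extends `A` over the path, and the leaf bound
  -- for these trees limits `m`.
  module Comb
    {ℓ} (atMost : LeavesAtMost ℓ)
    {W : Pred (Fin n) 0ℓ} (W? : Decidable W) (A : Arborescence W)
    (m : ℕ) (x u : ℕ → Fin n)
    (x-injective : ∀ {i j} → i < m → j < m → x i ≡ x j → i ≡ j)
    (x∉W   : ∀ {k} → k < m → ¬ W (x k))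
    (x-arc : ∀ {k} → suc k < m → R (x (suc k)) (x k))
    (u-arc : ∀ {k} → k < m → R (u k) (x k))
    (u-in  : ∀ {k} → k < m → W (u k) ⊎ ∃ λ c → 2 + c ≤ k × u k ≡ x c)
    where

    OnComb : Pred (Fin n) 0ℓ
    OnComb v = ∃ λ k → k < m × x k ≡ v

    onComb? : Decidable OnComb
    onComb? v = anyUpTo? (λ k → x k ≟ v) m

    -- Going up by x (suc k) always precedes a jump down by at least 2, so
    -- parents chosen by an S without consecutive members never form a cycle.
    module Shifted {S : Pred ℕ 0ℓ} (S? : Decidable S)
                   (S-step : ∀ {k} → S k → suc k < m × ¬ S (suc k)) where

      hang : ℕ → Fin n
      hang k with S? k
      ... | yes _ = x (suc k)
      ... | no  _ = u k

      hang-yes : ∀ {k} → S k → hang k ≡ x (suc k)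
      hang-yes {k} s with S? k
      ... | yes _ = refl
      ... | no ¬s = contradiction s ¬s

      hang-no : ∀ {k} → ¬ S k → hang k ≡ u k
      hang-no {k} ¬s with S? k
      ... | yes s = contradiction s ¬s
      ... | no  _ = refl

      private
        V : Pred (Fin n) 0ℓ
        V v = W v ⊎ OnComb v

        p : Fin n → Fin n
        p v with onComb? v
        ... | yes (k , _) = hang k
        ... | no  _       = parent A v

        p-x : ∀ {k} → k < m → p (x k) ≡ hang k
        p-x {k} k<m with onComb? (x k)
        ... | yes (j , j<m , eq) = cong hang (x-injective j<m k<m eq)
        ... | no  ¬c             = contradiction (k , k<m , refl) ¬c

        p-W : ∀ {v} → W v → p v ≡ parent A v
        p-W {v} v∈ with onComb? v
        ... | yes (j , j<m , refl) = contradiction v∈ (x∉W j<m)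
        ... | no  _                = refl

        climb-W : ∀ {v} → W v → Climb p (root A) v
        climb-W v∈ = climb-transfer (closed A) p-W v∈ (climb A v∈)

        u∈V : ∀ {k} → k < m → V (u k)
        u∈V k<m with u-in k<m
        ... | inj₁ u∈             = inj₁ u∈
        ... | inj₂ (c , c≤k , eq) = inj₂ (c , <-trans (<-trans (n<1+n c) c≤k) k<m , sym eq)

        climb-x : ∀ k → k < m → Climb p (root A) (x k)
        climb-x = <-rec _ λ k ih k<m →
          climb-up (subst (Climb p (root A)) (sym (p-x k<m)) (go ih k<m))
          where
          ClimbsBelow : ℕ → Set
          ClimbsBelow k = ∀ {c} → c < k → c < m → Climb p (root A) (x c)

          -- Used with `j = k` when `x k` hangs from `u k`, and with `j = suc k` after one step up:
          -- there `2 + c ≤ suc k` still gives `c < k`.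
          climb-u : ∀ {j k} → ClimbsBelow k → k < m → j < m → (∀ {c} → 2 + c ≤ j → c < k) →
                    Climb p (root A) (u j)
          climb-u ih k<m j<m smaller with u-in j<m
          ... | inj₁ u∈             = climb-W u∈
          ... | inj₂ (c , c≤j , eq) =
            subst (Climb p (root A)) (sym eq) (ih (smaller c≤j) (<-trans (smaller c≤j) k<m))

          go : ∀ {k} → ClimbsBelow k → k < m → Climb p (root A) (hang k)
          go {k} ih k<m with S? k
          ... | no  _ = climb-u ih k<m k<m (<-trans (n<1+n _))
          ... | yes s =
            let 1+k<m , ¬s = S-step s
            in  climb-up (subst (Climb p (root A)) (sym (trans (p-x 1+k<m) (hang-no ¬s)))
                  (climb-u ih k<m 1+k<m ℕ.≤-pred))

        B : Arborescence V
        B .root   = root A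
        B .parent = p
        B .root∈  = inj₁ (root∈ A)
        B .closed (inj₁ v∈) v≢r = inj₁ (subst W (sym (p-W v∈)) (closed A v∈ v≢r))
        B .closed (inj₂ (k , k<m , refl)) _ rewrite p-x k<m with S? k
        ... | yes s = inj₂ (suc k , proj₁ (S-step s) , refl)
        ... | no  _ = u∈V k<m
        B .arc {v} (inj₁ v∈) v≢r = subst (λ z → R z v) (sym (p-W v∈)) (arc A v∈ v≢r)
        B .arc (inj₂ (k , k<m , refl)) _ rewrite p-x k<m with S? k
        ... | yes s = x-arc (proj₁ (S-step s))
        ... | no  _ = u-arc k<m
        B .climb (inj₁ v∈)               = climb-W v∈
        B .climb (inj₂ (k , k<m , refl)) = climb-x k k<m

      Childless : Pred ℕ 0ℓ
      Childless k = ∀ {d} → d < m → hang d ≢ x k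

      childless? : Decidable Childless
      childless? k = allUpTo? (λ d → ¬? (hang d ≟ x k)) m

      -- These vertices are leaves of `B`: a non-root vertex of `W` keeps its parent in `W`, so only
      -- vertices of the run could be their children.
      childless≤ : length (filter childless? (upTo m)) ≤ ℓ
      childless≤ = subst (_≤ ℓ) (length-map x K) (atMost (λ v → W? v ⊎-dec onComb? v) B
        (map x K , unique , All.tabulate leaf , ≤-refl))
        where
        K = filter childless? (upTo m)

        K⁻ : ∀ {k} → k ∈ K → k < m × Childless k
        K⁻ k∈ = let k∈′ , c = ∈-filter⁻ childless? {xs = upTo m} k∈ in ∈-upTo⁻ k∈′ , c

        unique : Unique (map x K)
        unique = unique-map (λ j∈ k∈ → x-injective (proj₁ (K⁻ j∈)) (proj₁ (K⁻ k∈)))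
          (filter⁺ childless? (upTo⁺ m))

        leaf : ∀ {v} → v ∈ map x K → Leaf B v
        leaf v∈ with ∈-map⁻ x v∈
        ... | k , k∈ , refl = inj₂ (k , proj₁ (K⁻ k∈) , refl) , λ
          { (inj₁ w∈) w≢r eq →
              x∉W (proj₁ (K⁻ k∈)) (subst W (trans (sym (p-W w∈)) eq) (closed A w∈ w≢r))
          ; (inj₂ (d , d<m , refl)) _ eq → proj₂ (K⁻ k∈) d<m (trans (sym (p-x d<m)) eq) }

    private
      InImage : Pred ℕ 0ℓ
      InImage k = ∃ λ d → d < m × u d ≡ x k

      inImage? : Decidable InImage
      inImage? k = anyUpTo? (λ d → u d ≟ x k) m

      -- If `u (suc j)` is `x (suc d)`, then `d` can move to the parent `x (suc d)` at no cost as
      -- long as `suc j` stays there; so `suc j` has to avoid the colour of `d`, which is `lower j`.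
      -- The minimum with `j` secures `lower j ≤ j` for all `j`, and `0` is a filler when
      -- `u (suc j)` is not on the run.
      lower : ℕ → ℕ
      lower j with onComb? (u (suc j))
      ... | yes (c , _) = pred c ⊓ j
      ... | no  _       = 0

      lower≤ : ∀ j → lower j ≤ j
      lower≤ j with onComb? (u (suc j))
      ... | yes (c , _) = m⊓n≤n (pred c) j
      ... | no  _       = z≤n

      lower-spec : ∀ {j d} → suc d < m → d ≤ j → u (suc j) ≡ x (suc d) → lower j ≡ d
      lower-spec {j} {d} d<m d≤j eq with onComb? (u (suc j))
      ... | no ¬c = contradiction (suc d , d<m , sym eq) ¬c
      ... | yes (c , c<m , eq′) rewrite x-injective c<m d<m (trans eq′ eq) = m≤n⇒m⊓n≡m d≤j

      colouring = three-colouring lower lower≤ m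

      colour : ℕ → Fin 3
      colour = proj₁ colouring

      colour-suc : ∀ {k} → k < m → colour (suc k) ≢ colour k
      colour-suc k<m = proj₁ (proj₂ colouring k<m)

      colour-u : ∀ {j d} → j < m → suc d < m → u j ≡ x (suc d) → colour j ≢ colour d
      colour-u {j} {d} j<m d<m eq with u-in j<m
      ... | inj₁ u∈ = contradiction (subst W eq u∈) (x∉W d<m)
      ... | inj₂ (c , c≤j , eq′)
        with refl ← x-injective (<-trans (<-trans (n<1+n c) c≤j) j<m) d<m (trans (sym eq′) eq)
        with s≤s {n = j′} d<j′ ← c≤j =
          subst (λ z → colour (suc j′) ≢ colour z)
            (lower-spec d<m (<⇒≤ (<-trans (n<1+n d) d<j′)) eq)
            (proj₂ (proj₂ colouring (<-trans (n<1+n j′) j<m)))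

      -- The members move from `u k` to `x (suc k)`, which is a parent already when every vertex
      -- hangs from its `u`.
      Class : Fin 3 → Pred ℕ 0ℓ
      Class a k = suc k < m × colour k ≡ a × InImage (suc k)

      class? : ∀ a → Decidable (Class a)
      class? a k = (suc k ℕ.<? m) ×-dec (colour k ≟ a) ×-dec inImage? (suc k)

      class : Fin 3 → List ℕ
      class a = filter (class? a) (upTo m)

      -- The parent x (suc d) of each d in the class is also the parent of some j
      -- outside it, so the members of the class use up no vertices as parents.
      class≤ : ∀ a → length (class a) ≤ ℓ
      class≤ a = +-cancelʳ-≤ (length rest) _ _ (begin
        length (class a) + length rest           ≡⟨ length-filter-¬ (class? a) (upTo m) ⟩
        length (upTo m)                          ≡⟨ length-map x (upTo m) ⟨
        length (map x (upTo m))                  ≤⟨ unique⊆⇒length≤ unique covered ⟩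
        length (map x K ++ map hang rest)        ≡⟨ length-++ (map x K) ⟩
        length (map x K) + length (map hang rest)
          ≡⟨ cong₂ _+_ (length-map x K) (length-map hang rest) ⟩
        length K + length rest                   ≤⟨ +-monoˡ-≤ (length rest) childless≤ ⟩
        ℓ + length rest                          ∎)
        where
        open ≤-Reasoning
        open Shifted (class? a) (λ (k<m , c≡a , _) → k<m , λ (_ , c≡a′ , _) →
          colour-suc (<-trans (n<1+n _) k<m) (trans c≡a′ (sym c≡a)))
        rest = filter (¬? ∘ class? a) (upTo m)
        K = filter childless? (upTo m)

        unique : Unique (map x (upTo m))
        unique = unique-map (λ j∈ k∈ → x-injective (∈-upTo⁻ j∈) (∈-upTo⁻ k∈)) (upTo⁺ m)

        hit : ∀ {d} → d < m → Dec (Class a d) → hang d ∈ map hang rest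
        hit d<m (no ¬s) = ∈-map⁺ hang (∈-filter⁺ (¬? ∘ class? a) (∈-upTo⁺ d<m) ¬s)
        hit _ (yes s@(1+d<m , c≡a , j , j<m , eq)) = subst (_∈ map hang rest)
          (trans (hang-no ¬s) (trans eq (sym (hang-yes s))))
          (∈-map⁺ hang (∈-filter⁺ (¬? ∘ class? a) (∈-upTo⁺ j<m) ¬s))
          where
          ¬s : ¬ Class a j
          ¬s (_ , c≡a′ , _) = colour-u j<m 1+d<m eq (trans c≡a′ (sym c≡a))

        covered : map x (upTo m) ⊆ map x K ++ map hang rest
        covered v∈ with ∈-map⁻ x v∈
        ... | k , k∈ , refl with anyUpTo? (λ d → hang d ≟ x k) m
        ...   | yes (d , d<m , eq) =
                  ∈-++⁺ʳ (map x K) (subst (_∈ map hang rest) eq (hit d<m (class? a d)))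
        ...   | no none = ∈-++⁺ˡ (∈-map⁺ x
                  (∈-filter⁺ childless? k∈ λ d<m eq → none (_ , d<m , eq)))

    -- Let every `x k` hang from `u k`, so that nothing is shifted. An index is then childless, or
    -- it is `suc k` with `k` in one of the three colour classes, or it is `0`, which is no
    -- successor and accounts for the summand 1.
    comb-length : m ≤ 1 + (ℓ + 3 * ℓ)
    comb-length = begin
      m                                  ≡⟨ length-upTo m ⟨
      length (upTo m)                    ≤⟨ unique⊆⇒length≤ (upTo⁺ m) covered ⟩
      1 + length (K ++ shifted)          ≡⟨ cong suc (length-++ K) ⟩
      1 + (length K + length shifted)    ≤⟨ s≤s (+-mono-≤ childless≤ shifted≤) ⟩
      1 + (ℓ + 3 * ℓ)                    ∎
      where
      open ≤-Reasoning
      open Shifted {S = λ _ → ⊥} (λ _ → no id) ⊥-elim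
      K = filter childless? (upTo m)
      shifted = concatMap (map suc ∘ class) (allFin 3)

      shifted≤ : length shifted ≤ 3 * ℓ
      shifted≤ = length-concatMap≤ (map suc ∘ class)
        (λ a → subst (_≤ ℓ) (sym (length-map suc (class a))) (class≤ a)) (allFin 3)

      covered : upTo m ⊆ 0 ∷ (K ++ shifted)
      covered {zero}  _ = here refl
      covered {suc k} k∈ with inImage? (suc k)
      ... | no ¬image = there (∈-++⁺ˡ (∈-filter⁺ childless? k∈ λ d<m eq → ¬image (_ , d<m , eq)))
      ... | yes image = there (∈-++⁺ʳ K (∈-concatMap⁺ (map suc ∘ class)
        (lose (∈-allFin (colour k)) (∈-map⁺ suc (∈-filter⁺ (class? (colour k))
          (∈-upTo⁺ (<-trans (n<1+n k) (∈-upTo⁻ k∈))) (∈-upTo⁻ k∈ , refl , image))))))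

-- Out-branchings from parent functions

module _ {n : ℕ} where

  module _ {P : Fin n → Fin n → Set} (P? : ∀ u v → Dec (P u v)) where

    toArcSet : ArcSet n
    toArcSet = tabulate λ u → tabulate λ v → does (P? u v)

    lookup-toArcSet : ∀ u v → lookup (lookup toArcSet u) v ≡ does (P? u v)
    lookup-toArcSet u v = trans (cong (λ A → lookup A v) (lookup∘tabulate _ u)) (lookup∘tabulate _ v)

    toArcSet⁺ : ∀ {u v} → P u v → Arc toArcSet u v
    toArcSet⁺ {u} {v} p = lookup⇒[]= v _ (trans (lookup-toArcSet u v) (dec-true (P? u v) p))

    toArcSet⁻ : ∀ {u v} → Arc toArcSet u v → P u v
    toArcSet⁻ {u} {v} a with P? u v | trans (sym (lookup-toArcSet u v)) ([]=⇒lookup a)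
    ... | yes p | _ = p

  module ParentArcs (p : Fin n → Fin n) (r : Fin n) (climbs : ∀ v → Climb p r v) where

    Child : Fin n → Fin n → Set
    Child u v = v ≢ r × p v ≡ u

    child? : ∀ u v → Dec (Child u v)
    child? u v = ¬? (v ≟ r) ×-dec p v ≟ u

    T : ArcSet n
    T = toArcSet child?

    depth : Fin n → ℕ
    depth v = height (climbs v)

    depth-child : ∀ {u v} → Child u v → depth v ≡ suc (depth u)
    depth-child {v = v} (v≢r , refl) = height-unique (climbs v) (up v≢r (climbs (p v)))

    depth-< : ∀ {u v} → Child u v → depth u < depth v
    depth-< c = ≤-reflexive (sym (depth-child c))

    last : Fin n → List (Fin n) → Fin n
    last a []       = a
    last _ (b ∷ bs) = last b bs

    last-∷ʳ : ∀ a bs z → last a (bs ∷ʳ z) ≡ z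
    last-∷ʳ a []       z = refl
    last-∷ʳ a (b ∷ bs) z = last-∷ʳ b bs z

    penultimate : Fin n → Fin n → List (Fin n) → Fin n
    penultimate a b []       = a
    penultimate a b (c ∷ cs) = penultimate b c cs

    penultimate-∷ʳ : ∀ a b bs z → penultimate a b (bs ∷ʳ z) ≡ last b bs
    penultimate-∷ʳ a b []       z = refl
    penultimate-∷ʳ a b (c ∷ cs) z = penultimate-∷ʳ b c cs z

    last∈ : ∀ b bs → last b bs ∈ b ∷ bs
    last∈ b []       = here refl
    last∈ b (c ∷ cs) = there (last∈ c cs)

    data NoBacktrack : List (Fin n) → Set where
      two  : ∀ {a b} → NoBacktrack (a ∷ b ∷ [])
      more : ∀ {a b c cs} → a ≢ c → NoBacktrack (b ∷ c ∷ cs) → NoBacktrack (a ∷ b ∷ c ∷ cs)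

    noBacktrack-∷ʳ : ∀ {a b cs z} → Unique (a ∷ b ∷ cs) → z ∉ a ∷ b ∷ cs →
                     NoBacktrack (a ∷ b ∷ cs ∷ʳ z)
    noBacktrack-∷ʳ {cs = []}     _                    z∉ = more (λ { refl → z∉ (here refl) }) two
    noBacktrack-∷ʳ {cs = c ∷ cs} ((_ ∷ a≢c ∷ _) ∷ uq) z∉ = more a≢c (noBacktrack-∷ʳ uq (z∉ ∘ there))

    Edge : Fin n → Fin n → Set
    Edge u v = Child u v ⊎ Child v u

    -- A walk without backtracking that goes down once never goes up again,
    -- as a vertex has only one parent.
    descends : ∀ {a b cs} → Child a b → Linked Edge (b ∷ cs) → NoBacktrack (a ∷ b ∷ cs) →
               depth a < depth (last b cs)
    descends down [-] _ = depth-< down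
    descends down (inj₁ down′ ∷ walk) (more a≢c nb) =
      <-trans (depth-< down) (descends down′ walk nb)
    descends (_ , pb≡a) (inj₂ (_ , pb≡c) ∷ _) (more a≢c _) =
      contradiction (trans (sym pb≡a) pb≡c) a≢c

    ends-descending : ∀ {a b cs} → Child a b → Linked Edge (b ∷ cs) → NoBacktrack (a ∷ b ∷ cs) →
                      Child (penultimate a b cs) (last b cs)
    ends-descending down [-] _ = down
    ends-descending down (inj₁ down′ ∷ walk) (more _ nb) = ends-descending down′ walk nb
    ends-descending (_ , pb≡a) (inj₂ (_ , pb≡c) ∷ _) (more a≢c _) =
      contradiction (trans (sym pb≡a) pb≡c) a≢c

    -- A walk without backtracking first rises and then falls, so it rises throughout or its last
    -- step goes down.
    ascends⊎ends-descending : ∀ {a b cs} → Linked Edge (a ∷ b ∷ cs) → NoBacktrack (a ∷ b ∷ cs) →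
      depth (last b cs) < depth a ⊎ Child (penultimate a b cs) (last b cs)
    ascends⊎ends-descending (inj₁ down ∷ walk) nb = inj₂ (ends-descending down walk nb)
    ascends⊎ends-descending (inj₂ rise ∷ [-]) nb = inj₁ (depth-< rise)
    ascends⊎ends-descending (inj₂ rise ∷ walk@(_ ∷ _)) (more _ nb)
      with ascends⊎ends-descending walk nb
    ... | inj₁ ascent = inj₁ (<-trans ascent (depth-< rise))
    ... | inj₂ end    = inj₂ end

    -- If the cycle leaves `x` downwards, it descends throughout and cannot return to the depth of
    -- `x`. If it leaves upwards, to the parent `a` of `x`, it cannot rise throughout, so it comes
    -- back down to `x` from a parent of `x`; this is `a` again, although the vertices of a cycle
    -- are distinct.
    acyclic : ∀ {x xs} → ¬ IsCycle Edge x xs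
    acyclic {xs = _ ∷ []} (s≤s () , _)
    acyclic {x} {a ∷ b ∷ cs} (_ , x∉@(_ ∷ x≢b ∷ _) ∷ uq@(a∉ ∷ _) , edge ∷ walk) =
      case-edge edge
      where
      nb : NoBacktrack (x ∷ a ∷ b ∷ cs ∷ʳ x)
      nb = more x≢b (noBacktrack-∷ʳ uq λ x∈ → All.lookup x∉ x∈ refl)

      case-edge : ¬ Edge x a
      case-edge (inj₁ down) = n≮n _
        (subst (λ z → depth x < depth z) (last-∷ʳ a (b ∷ cs) x) (descends down walk nb))
      case-edge (inj₂ (_ , px≡a)) with ascends⊎ends-descending (edge ∷ walk) nb
      ... | inj₁ ascent = n≮n _ (subst (λ z → depth z < depth x) (last-∷ʳ a (b ∷ cs) x) ascent)
      ... | inj₂ (_ , p-last≡) = All.lookup a∉ (last∈ b cs) (begin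
        a                                 ≡⟨ px≡a ⟨
        p x                               ≡⟨ cong p (last-∷ʳ a (b ∷ cs) x) ⟨
        p (last a (b ∷ cs ∷ʳ x))          ≡⟨ p-last≡ ⟩
        penultimate x a (b ∷ cs ∷ʳ x)     ≡⟨ penultimate-∷ʳ x a (b ∷ cs) x ⟩
        last b cs                         ∎)
        where open ≡-Reasoning

    edge⁻ : ∀ {u v} → Adjacent T u v → Edge u v
    edge⁻ (inj₁ a) = inj₁ (toArcSet⁻ child? a)
    edge⁻ (inj₂ a) = inj₂ (toArcSet⁻ child? a)

    to-root : ∀ {v} → Climb p r v → Star (Adjacent T) v r
    to-root stop       = ε
    to-root (up v≢r c) = inj₂ (toArcSet⁺ child? (v≢r , refl)) ◅ to-root c

    isOrientedTree : IsOrientedTree T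
    isOrientedTree = orientedTree
      (λ a b → <-asym (depth-< (toArcSet⁻ child? a)) (depth-< (toArcSet⁻ child? b)))
      (λ u v → to-root (climbs u) ◅◅ reverse swap (to-root (climbs v)))
      (λ (x , xs , len , uq , walk) → acyclic (len , uq , Linked.map edge⁻ walk))

    uniqueRoot : inDegree T r ≡ 0 × (∀ {v} → inDegree T v ≡ 0 → r ≡ v)
    uniqueRoot = cong length (filter-none (λ u → arc? T u r)
                   (All.universal (λ u a → proj₁ (toArcSet⁻ child? {u} a) refl) (allFin n)))
               , only
      where
      only : ∀ {v} → inDegree T v ≡ 0 → r ≡ v
      only {v} eq with v ≟ r
      ... | yes v≡r = sym v≡r
      ... | no  v≢r = contradiction eq (nonempty (∈-filter⁺ (λ u → arc? T u v) (∈-allFin (p v))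
                                                   (toArcSet⁺ child? (v≢r , refl))))
        where
        nonempty : ∀ {x : Fin n} {xs} → x ∈ xs → length xs ≢ 0
        nonempty (here _)  ()
        nonempty (there _) ()

    isOutTree : IsOutTree T
    isOutTree = outTree isOrientedTree (r , uniqueRoot)

  module _ (D : Digraph n) where
    open Arborescences (Arc (arcs D))
    open Arborescence

    hasLeaves≤ℓₛ : ∀ (A : Spanning) {k} → HasLeaves A k → k ≤ ℓₛ D
    hasLeaves≤ℓₛ A (L , unique , leaf , k≤) = begin
      _                  ≤⟨ k≤ ⟩
      length L           ≤⟨ unique⊆⇒length≤ unique L⊆ ⟩
      length (leaves T)  ≤⟨ leaves≤ℓₛ D (outBranching subdigraph isOutTree) ⟩
      ℓₛ D               ∎
      where
      open ≤-Reasoning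
      open ParentArcs (parent A) (root A) (λ _ → climb A tt)

      subdigraph : ∀ {u v} → Arc T u v → Arc (arcs D) u v
      subdigraph a with v≢r , refl ← toArcSet⁻ child? a = arc A tt v≢r

      L⊆ : L ⊆ leaves T
      L⊆ {v} v∈L = ∈-filter⁺ (λ v → outDegree T v ℕ.≟ 0) (∈-allFin v)
        (cong length (filter-none (arc? T v) (All.universal
          (λ u a → let u≢r , eq = toArcSet⁻ child? a in proj₂ (All.lookup leaf v∈L) tt u≢r eq)
          (allFin n))))

-- Unbranched paths in an arborescence with the most leaves

module _ {n : ℕ} {R : Fin n → Fin n → Set} where
  open Arborescences R
  open Arborescence

  rehang : (T : Spanning) → ∀ {a y} → ¬ Below (parent T) (root T) a y → R y a → Spanning
  rehang T {a} {y} ¬below y→a = record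
    { root = root T ; parent = parent T [ a ≔ y ] ; root∈ = tt ; closed = λ _ _ → tt
    ; arc = arc′ ; climb = λ {v} _ → reroute ¬below (λ _ → climb T tt) v }
    where
    arc′ : ∀ {v} → U v → v ≢ root T → R ((parent T [ a ≔ y ]) v) v
    arc′ {v} _ v≢r with v ≟ a
    ... | yes refl = y→a
    ... | no  _    = arc T tt v≢r

  module Maximal
    (irreflexive : ∀ {v} → ¬ R v v)
    (other : Fin n → Fin n → Fin n → Fin n)
    (other-spec : ∀ {a v b} → R a v → R v b → R (other a v b) v × other a v b ≢ a × other a v b ≢ b)
    {ℓ} (atMost : LeavesAtMost ℓ) (T : Spanning) (attained : HasLeaves T ℓ)
    where

    private
      p = parent T
      r = root T

      depth : Fin n → ℕ
      depth v = height (climb T {v} tt)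

      depth-parent : ∀ {v} → v ≢ r → depth (p v) < depth v
      depth-parent {v} v≢r = ≤-reflexive (height-unique (up v≢r (climb T tt)) (climb T {v} tt))

      depth-below : ∀ {a u} → Below p r a u → depth a ≤ depth u
      depth-below here          = ≤-refl
      depth-below (below u≢r b) = ≤-trans (depth-below b) (<⇒≤ (depth-parent u≢r))

    ancestor : Fin n → ℕ → Fin n
    ancestor e zero    = e
    ancestor e (suc j) = p (ancestor e j)

    -- Indices count upwards from the lower end `e`, whose own children are unrestricted; the upper
    -- end `ancestor e t` may be the root.
    record Segment (e : Fin n) (t : ℕ) : Set where
      field
        proper    : ∀ {j} → j < t → ancestor e j ≢ r
        onlyChild : ∀ {j} → j < t → ∀ {v} → v ≢ r → p v ≡ ancestor e (suc j) → v ≡ ancestor e j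

    module OnSegment {e s} (segment : Segment e (suc s)) where
      open Segment segment

      z = ancestor e

      z-arc : ∀ {j} → j < suc s → R (z (suc j)) (z j)
      z-arc j<t = arc T tt (proper j<t)

      depth-z : ∀ {i j} → i < j → j ≤ suc s → depth (z j) < depth (z i)
      depth-z {i} {suc j} i<1+j j<t with m<1+n⇒m<n∨m≡n i<1+j
      ... | inj₁ i<j  = <-trans (depth-parent (proper j<t)) (depth-z i<j (<⇒≤ j<t))
      ... | inj₂ refl = depth-parent (proper j<t)

      z-injective : ∀ {i j} → i ≤ suc s → j ≤ suc s → z i ≡ z j → i ≡ j
      z-injective {i} {j} i≤t j≤t eq with <-cmp i j
      ... | tri< i<j _ _ = contradiction (cong depth (sym eq)) (<⇒≢ (depth-z i<j j≤t))
      ... | tri≈ _ i≡j _ = i≡j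
      ... | tri> _ _ j<i = contradiction (cong depth eq) (<⇒≢ (depth-z j<i i≤t))

      ¬below-z : ∀ {i j} → i < j → j ≤ suc s → ¬ Below p r (z i) (z j)
      ¬below-z i<j j≤t b = <⇒≱ (depth-z i<j j≤t) (depth-below b)

      z-below : ∀ {j} k → k + j ≤ suc s → Below p r (z (k + j)) (z j)
      z-below zero    _ = here
      z-below {j} (suc k) k+j≤t = subst (λ i → Below p r (z i) (z j)) (+-suc k j)
        (below (proper (≤-trans (s≤s (m≤n+m j k)) k+j≤t))
          (z-below {suc j} k (subst (_≤ suc s) (sym (+-suc k j)) k+j≤t)))

      below-top : ∀ {j} → j ≤ suc s → Below p r (z (suc s)) (z j)
      below-top {j} j≤t = subst (λ i → Below p r (z i) (z j)) (m∸n+n≡m j≤t)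
        (z-below (suc s ∸ j) (≤-reflexive (m∸n+n≡m j≤t)))

      -- The segment has no side branches: a child of `z (suc c)` can only be `z c`, which for
      -- `c = 0` is `e` itself.
      below-split : ∀ {u} → Below p r (z (suc s)) u →
                    Below p r e u ⊎ ∃ λ c → suc c ≤ suc s × u ≡ z (suc c)
      below-split here = inj₂ (s , ≤-refl , refl)
      below-split (below u≢r b) with below-split b
      ... | inj₁ b′ = inj₁ (below u≢r b′)
      ... | inj₂ (c , c<t , eq) with onlyChild c<t u≢r eq
      ...   | u≡zc with c
      ...     | zero  = inj₁ (subst (Below p r e) (sym u≡zc) here)
      ...     | suc d = inj₂ (d , <⇒≤ c<t , u≡zc)

      -- For `i < s` the `y i` are the interior vertices of the segment; `w i` is an in-neighbour of
      -- `y i` apart from its tree neighbours `z (2 + i)` and `z i`.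
      y w : ℕ → Fin n
      y i = z (suc i)
      w i = other (z (2 + i)) (y i) (z i)

      w-spec : ∀ {i} → i < s → R (w i) (y i) × w i ≢ z (2 + i) × w i ≢ z i
      w-spec i<s = other-spec (z-arc (s≤s i<s)) (z-arc (m<n⇒m<1+n i<s))

      -- Otherwise rehanging y i below w i turns its parent z (2 + i) into a
      -- new leaf.
      w-descends : ∀ {i c} → i < s → c ≤ suc s → w i ≡ z c → c < i
      w-descends {i} {c} i<s c≤t eq with <-cmp c (suc i)
      ... | tri≈ _ refl _ =
              contradiction (subst (λ v → R v (y i)) eq (proj₁ (w-spec i<s))) irreflexive
      ... | tri< c<1+i _ _ with m<1+n⇒m<n∨m≡n c<1+i
      ...   | inj₁ c<i  = c<i
      ...   | inj₂ refl = contradiction eq (proj₂ (proj₂ (w-spec i<s)))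
      w-descends {i} {c} i<s c≤t eq | tri> _ _ i<c with m≤n⇒m<n∨m≡n i<c
      ... | inj₂ refl = contradiction eq (proj₁ (proj₂ (w-spec i<s)))
      ... | inj₁ 2+i<c = contradiction (atMost (λ _ → yes tt) T′ (more attained)) 1+n≰n
        where
        T′ : Spanning
        T′ = rehang T {y i} {z c} (¬below-z i<c c≤t)
               (subst (λ v → R v (y i)) eq (proj₁ (w-spec i<s)))

        hanging : ∀ {u v} → parent T′ u ≡ v → (u ≡ y i × z c ≡ v) ⊎ (u ≢ y i × p u ≡ v)
        hanging {u} eq′ with u ≟ y i
        ... | yes u≡y = inj₁ (u≡y , eq′)
        ... | no  u≢y = inj₂ (u≢y , eq′)

        z-parent : ∀ {j v} → j < suc s → Leaf T v → z (suc j) ≢ v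
        z-parent j<t (_ , childless) = childless tt (proper j<t)

        new-leaf : Leaf T′ (z (2 + i))
        new-leaf = tt , λ {u} _ u≢r eq′ → case-hanging u≢r (hanging eq′)
          where
          case-hanging : ∀ {u} → u ≢ r →
                         ¬ ((u ≡ y i × z c ≡ z (2 + i)) ⊎ (u ≢ y i × p u ≡ z (2 + i)))
          case-hanging _ (inj₁ (_ , eq′)) =
            <⇒≢ 2+i<c (sym (z-injective c≤t (≤-trans (<⇒≤ 2+i<c) c≤t) eq′))
          case-hanging u≢r (inj₂ (u≢y , eq′)) = u≢y (onlyChild (s≤s i<s) u≢r eq′)

        -- Only `z c` gains a child, and it is no leaf of `T`, having the child `z (c - 1)` there.
        old-leaf : ∀ {v} → Leaf T v → Leaf T′ v
        old-leaf {v} leaf@(_ , childless) = tt , λ {u} _ u≢r eq′ → case-hanging u≢r (hanging eq′)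
          where
          z-c : ∀ {c} → 2 + i < c → c ≤ suc s → z c ≢ v
          z-c (s≤s _) c≤t = z-parent c≤t leaf

          case-hanging : ∀ {u} → u ≢ r → ¬ ((u ≡ y i × z c ≡ v) ⊎ (u ≢ y i × p u ≡ v))
          case-hanging _   (inj₁ (_ , eq′)) = z-c 2+i<c c≤t eq′
          case-hanging u≢r (inj₂ (_ , eq′)) = childless tt u≢r eq′

        more : HasLeaves T ℓ → HasLeaves T′ (suc ℓ)
        more (L , unique , leaf , ℓ≤) = z (2 + i) ∷ L ,
          All.tabulate (λ v∈ eq′ → z-parent (s≤s i<s) (All.lookup leaf v∈) eq′) ∷ unique ,
          new-leaf ∷ All.map old-leaf leaf , s≤s ℓ≤

      -- The comb `y 0, …, y (b - 1)` stands on the subtree at `e`: each `w i` is a descendant of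
      -- the top, so it lies in this subtree or on the segment, and in the latter case far enough
      -- below `y i`.
      module Lower {b} (b≤s : b ≤ s) (good : ∀ {i} → i < b → Below p r (z (suc s)) (w i)) where

        W : Pred (Fin n) 0ℓ
        W = Below p r e

        tree : Arborescence W
        tree .root   = e
        tree .parent = p
        tree .root∈  = here
        tree .closed here        v≢e = contradiction refl v≢e
        tree .closed (below _ b) _   = b
        tree .arc here           v≢e = contradiction refl v≢e
        tree .arc (below v≢r _)  _   = arc T tt v≢r
        tree .climb b = climb-W b
          where
          climb-W : ∀ {v} → Below p r e v → Climb p e v
          climb-W here        = stop
          climb-W (below _ b) = climb-up (climb-W b)

        bound : b ≤ 1 + (ℓ + 3 * ℓ)
        bound = Comb.comb-length atMost (λ v → below? e (climb T {v} tt)) tree b y w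
          (λ i<b j<b eq → suc-injective (z-injective (in-range i<b) (in-range j<b) eq))
          (λ i<b → ¬below-z (s≤s z≤n) (in-range i<b))
          (λ i<b → z-arc (in-range i<b))
          (λ i<b → proj₁ (w-spec (≤-trans i<b b≤s)))
          w-in
          where
          in-range : ∀ {i} → i < b → suc i ≤ suc s
          in-range i<b = m≤n⇒m≤1+n (≤-trans i<b b≤s)

          w-in : ∀ {i} → i < b → W (w i) ⊎ ∃ λ c → 2 + c ≤ i × w i ≡ y c
          w-in i<b with below-split (good i<b)
          ... | inj₁ b              = inj₁ b
          ... | inj₂ (c , c<t , eq) = inj₂ (c , w-descends (≤-trans i<b b≤s) c<t eq , eq)

      -- Once `y b` hangs from `w b`, the `m` interior vertices above `y b` can be cut out: the
      -- remaining vertices still form a tree, and the removed ones are a comb over it. The upper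
      -- end of the segment stays in the tree.
      module Upper {b} (b<s : b < s) (bad : ¬ Below p r (z (suc s)) (w b)) where

        m = s ∸ suc b

        x u : ℕ → Fin n
        x c = y (suc b + c)
        u c = w (suc b + c)

        in-range : ∀ {c} → c < m → suc b + c < s
        in-range {c} c<m = subst (suc b + c <_) (m+[n∸m]≡n b<s) (+-monoʳ-< (suc b) c<m)

        in-range′ : ∀ {c} → c < m → 2 + b + c ≤ suc s
        in-range′ c<m = m≤n⇒m≤1+n (in-range c<m)

        onComb? : Decidable λ v → ∃ λ c → c < m × x c ≡ v
        onComb? v = anyUpTo? (λ c → x c ≟ v) m

        W : Pred (Fin n) 0ℓ
        W v = ¬ ∃ λ c → c < m × x c ≡ v

        T′ : Spanning
        T′ = rehang T {y b} {w b}
               (λ below-yb → bad (below-trans below-yb (below-top (m≤n⇒m≤1+n b<s))))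
               (proj₁ (w-spec b<s))
          where
          below-trans : ∀ {a v u} → Below p r v u → Below p r a v → Below p r a u
          below-trans here          b = b
          below-trans (below v≢r c) b = below v≢r (below-trans c b)

        tree : Arborescence W
        tree .root   = r
        tree .parent = parent T′
        tree .root∈ (c , c<m , eq) = proper (s≤s (in-range c<m)) eq
        -- A child in `T′` of a removed vertex would be `y b`, whose new parent is no descendant of
        -- the top, or else an only child in `T`, which is `y b` or removed itself.
        tree .closed {v} v∈ v≢r (c , c<m , eq) with v ≟ y b
        ... | yes refl = bad (subst (Below p r (z (suc s))) eq (below-top (in-range′ c<m)))
        ... | no v≢yb  with c | c<m | onlyChild (in-range′ c<m) v≢r (sym eq)
        ...   | zero  | _   | v≡ = v≢yb (trans v≡ (cong y (+-identityʳ b)))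
        ...   | suc d | d<m | v≡ =
                  v∈ (d , <-trans (n<1+n d) d<m , trans (cong y (sym (+-suc b d))) (sym v≡))
        tree .arc _ v≢r = arc T′ tt v≢r
        tree .climb _   = climb T′ tt

        bound : m ≤ 1 + (ℓ + 3 * ℓ)
        bound = Comb.comb-length atMost (λ v → ¬? (onComb? v)) tree m x u
          (λ i<m j<m eq → +-cancelˡ-≡ (2 + b) _ _ (z-injective (in-range′ i<m) (in-range′ j<m) eq))
          (λ c<m x∈ → x∈ (_ , c<m , refl))
          (λ {c} c<m → subst (λ i → R (y i) (x c)) (sym (+-suc (suc b) c))
            (z-arc (s≤s (in-range (<-trans (n<1+n c) c<m)))))
          (λ c<m → proj₁ (w-spec (in-range c<m)))
          u-in
          where
          u-in : ∀ {k} → k < m → W (u k) ⊎ ∃ λ c → 2 + c ≤ k × u k ≡ x c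
          u-in {k} k<m with onComb? (u k)
          ... | no  u∈             = inj₁ u∈
          ... | yes (c , c<m , eq) = inj₂ (c ,
            +-cancelˡ-≤ (suc b) _ _ (subst (_≤ suc b + k)
              (sym (trans (+-suc (suc b) (suc c)) (cong suc (+-suc (suc b) c))))
              (w-descends (in-range k<m) (in-range′ c<m) (sym eq))) , sym eq)

    -- With `t = suc s`, cut the `s` interior vertices at the first `b` for which `w b` is no
    -- descendant of the top. The runs below and above `y b` have at most `1 + 4 * ℓ` vertices each,
    -- and `y b` itself adds one. Without such a `b`, the lower run is everything.
    segment-length : ∀ {e t} → Segment e t → t < 5 + 8 * ℓ
    segment-length {t = zero}  _ = s≤s z≤n
    segment-length {e} {suc s} segment
      with search-below (λ v → ¬? (below? (ancestor e (suc s)) (climb T {v} tt)))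
             s {OnSegment.w segment}
    ... | inj₁ none = s≤s (s≤s (≤-trans (OnSegment.Lower.bound segment ≤-refl good)
            (≤-trans (s≤s (*-monoˡ-≤ ℓ {4} {8} (m≤m+n 4 4))) (m≤n+m _ 2))))
      where
      good : ∀ {i} → i < s → _
      good i<s = decidable-stable (below? _ (climb T tt)) (none i<s)
    ... | inj₂ (b , b<s , bad , least) = s≤s (s≤s (begin
      s                                          ≡⟨ m+[n∸m]≡n b<s ⟨
      suc b + (s ∸ suc b)
        ≤⟨ +-mono-≤ (s≤s (OnSegment.Lower.bound segment (<⇒≤ b<s) good))
                    (OnSegment.Upper.bound segment b<s bad) ⟩
      (2 + 4 * ℓ) + (1 + 4 * ℓ)                  ≡⟨ arith ℓ ⟩
      3 + 8 * ℓ                                  ∎))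
      where
      open ≤-Reasoning
      good : ∀ {i} → i < b → _
      good i<b = decidable-stable (below? _ (climb T tt)) (least i<b)

      arith : ∀ ℓ → (2 + 4 * ℓ) + (1 + 4 * ℓ) ≡ 3 + 8 * ℓ
      arith = solve-∀

    -- Covering the tree by segments

    private
      Parental : Pred (Fin n) 0ℓ
      Parental v = ∃ λ u → u ≢ r × p u ≡ v

      parental? : Decidable Parental
      parental? v = any? λ u → ¬? (u ≟ r) ×-dec p u ≟ v

      firstChild : Fin n → Fin n
      firstChild v with parental? v
      ... | yes (u , _) = u
      ... | no  _       = v

      firstChild-spec : ∀ {v} → Parental v → firstChild v ≢ r × p (firstChild v) ≡ v
      firstChild-spec {v} parental with parental? v
      ... | yes (_ , spec)  = spec
      ... | no  ¬parental = contradiction parental ¬parental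

      Branching : Pred (Fin n) 0ℓ
      Branching v = ∃ λ u → u ≢ r × p u ≡ v × u ≢ firstChild v

      branching? : Decidable Branching
      branching? v = any? λ u → ¬? (u ≟ r) ×-dec p u ≟ v ×-dec ¬? (u ≟ firstChild v)

      childless = filter (¬? ∘ parental?) (allFin n)
      parents   = filter parental? (allFin n)
      branchings = filter branching? (allFin n)

      childless≤ : length childless ≤ ℓ
      childless≤ = atMost (λ _ → yes tt) T (childless , filter⁺ (¬? ∘ parental?) (allFin⁺ n) ,
        All.tabulate (λ v∈ → tt , λ {u} _ u≢r eq →
          proj₂ (∈-filter⁻ (¬? ∘ parental?) {xs = allFin n} v∈) (u , u≢r , eq)) , ≤-refl)

      -- Every parent has a first child and every branching vertex also another
      -- one, so there are at most n of both together.
      branchings≤ : length branchings ≤ ℓ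
      branchings≤ = ≤-trans (+-cancelˡ-≤ (length parents) _ _ (begin
        length parents + length branchings        ≤⟨ +-mono-≤
          (image≤ firsts (unique⊆⇒length≤ (filter⁺ parental? (allFin⁺ n)) parents⊆))
          (image≤ others (unique⊆⇒length≤ (filter⁺ branching? (allFin⁺ n)) branchings⊆)) ⟩
        length firsts + length others             ≡⟨ length-filter-¬ first? (allFin n) ⟩
        length (allFin n)                         ≡⟨ length-filter-¬ parental? (allFin n) ⟨
        length parents + length childless         ∎)) childless≤
        where
        open ≤-Reasoning
        first? : Decidable λ u → u ≡ firstChild (p u)
        first? u = u ≟ firstChild (p u)
        firsts = filter first? (allFin n)
        others = filter (¬? ∘ first?) (allFin n)

        image≤ : ∀ {k} vs → k ≤ length (map p vs) → k ≤ length vs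
        image≤ vs = subst (_ ≤_) (length-map p vs)

        parents⊆ : parents ⊆ map p firsts
        parents⊆ v∈ =
          let parental = proj₂ (∈-filter⁻ parental? {xs = allFin n} v∈)
              eq = proj₂ (firstChild-spec parental)
          in  subst (_∈ map p firsts) eq
                (∈-map⁺ p (∈-filter⁺ first? (∈-allFin _) (cong firstChild (sym eq))))

        branchings⊆ : branchings ⊆ map p others
        branchings⊆ v∈ with ∈-filter⁻ branching? {xs = allFin n} v∈
        ... | _ , u , _ , refl , u≢first = ∈-map⁺ p (∈-filter⁺ (¬? ∘ first?) (∈-allFin u) u≢first)

      -- The lower ends of the segments, from which `ancestor` starts.
      tops = childless ++ branchings

      InSegment : Pred (Fin n) 0ℓ
      InSegment v = ∃₂ λ e t → e ∈ tops × Segment e t × ancestor e t ≡ v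

      -- Descend from `v` along only children until a vertex with none or several. The recursion
      -- goes to greater depth and ends because there are finitely many vertices.
      in-segment : ∀ v → Acc (λ u v → depth v < depth u) v → InSegment v
      in-segment v (acc rec) = by-children (parental? v) (branching? v)
        where
        trivial : Segment v 0
        trivial = record { proper = λ () ; onlyChild = λ () }

        by-children : Dec (Parental v) → Dec (Branching v) → InSegment v
        by-children (no ¬parental) _ =
          v , 0 , ∈-++⁺ˡ (∈-filter⁺ (¬? ∘ parental?) (∈-allFin v) ¬parental) , trivial , refl
        by-children (yes _) (yes branching) =
          v , 0 , ∈-++⁺ʳ childless (∈-filter⁺ branching? (∈-allFin v) branching) , trivial , refl
        by-children (yes parental) (no ¬branching)
          with first≢r , pc≡v ← firstChild-spec parental
          with in-segment (firstChild v)
                 (rec (subst (λ u → depth u < depth (firstChild v)) pc≡v (depth-parent first≢r)))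
        ... | e , t , e∈ , segment , eq =
          e , suc t , e∈ , record { proper = proper′ ; onlyChild = onlyChild′ } ,
          trans (cong p eq) pc≡v
          where
          open Segment segment

          proper′ : ∀ {j} → j < suc t → ancestor e j ≢ r
          proper′ j<1+t with m<1+n⇒m<n∨m≡n j<1+t
          ... | inj₁ j<t  = proper j<t
          ... | inj₂ refl = first≢r ∘ trans (sym eq)

          onlyChild′ : ∀ {j} → j < suc t → ∀ {u} → u ≢ r → p u ≡ ancestor e (suc j) →
                       u ≡ ancestor e j
          onlyChild′ j<1+t {u} u≢r pu≡ with m<1+n⇒m<n∨m≡n j<1+t
          ... | inj₁ j<t  = onlyChild j<t u≢r pu≡
          ... | inj₂ refl with u ≟ firstChild v
          ...   | yes u≡first = trans u≡first (sym eq)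
          ...   | no  u≢first = contradiction
                  (u , u≢r , trans pu≡ (trans (cong p eq) pc≡v) , u≢first) ¬branching

      depth-noetherian : ∀ v → Acc (λ u v → depth v < depth u) v
      depth-noetherian = spo-noetherian (On.isStrictPartialOrder depth ℕ.<-isStrictPartialOrder)

    -- Each of the at most `ℓ + ℓ` lower ends accounts for at most `5 + 8 * ℓ` vertices. The lists
    -- `ancestors e` may run past the segment, which is harmless for an upper bound.
    order≤ : n ≤ (ℓ + ℓ) * (5 + 8 * ℓ)
    order≤ = begin
      n                                         ≡⟨ length-tabulate {n = n} id ⟨
      length (allFin n)                         ≤⟨ unique⊆⇒length≤ (allFin⁺ n) covered ⟩
      length (concatMap ancestors tops)         ≤⟨ length-concatMap≤ ancestors ancestors≤ tops ⟩
      length tops * (5 + 8 * ℓ)                 ≡⟨ cong (_* (5 + 8 * ℓ)) (length-++ childless) ⟩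
      (length childless + length branchings) * (5 + 8 * ℓ)
        ≤⟨ *-monoˡ-≤ (5 + 8 * ℓ) (+-mono-≤ childless≤ branchings≤) ⟩
      (ℓ + ℓ) * (5 + 8 * ℓ)                     ∎
      where
      open ≤-Reasoning
      ancestors : Fin n → List (Fin n)
      ancestors e = map (ancestor e) (upTo (5 + 8 * ℓ))

      ancestors≤ : ∀ e → length (ancestors e) ≤ 5 + 8 * ℓ
      ancestors≤ e = ≤-reflexive
        (trans (length-map (ancestor e) (upTo (5 + 8 * ℓ))) (length-upTo (5 + 8 * ℓ)))

      covered : allFin n ⊆ concatMap ancestors tops
      covered {v} _ with in-segment v (depth-noetherian v)
      ... | e , t , e∈ , segment , refl = ∈-concatMap⁺ ancestors
        (lose e∈ (∈-map⁺ (ancestor e) (∈-upTo⁺ (segment-length segment))))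

-- The degree conditions

quadratic≤cubic : ∀ m → (m + m) * (5 + 8 * m) ≤ 4 * (m + 1) ^ 3
quadratic≤cubic zero    = z≤n
-- Written in `k = m - 1`, the difference of the two sides has only positive coefficients; in `m` it
-- has not.
quadratic≤cubic (suc k) = ≤-trans (m≤m+n ((suc k + suc k) * (5 + 8 * suc k)) _)
  (≤-reflexive (sym (expand k)))
  where
  expand : ∀ k → let m = 1 + k in
           4 * ((m + 1) * ((m + 1) * ((m + 1) * 1))) ≡
           (m + m) * (5 + 8 * m) + (4 * (k * k * k) + 8 * (k * k) + 6 * k + 6)
  expand = solve-∀

module _ {n : ℕ} (D : Digraph n) where
  open Arborescences (Arc (arcs D))

  -- The common consequence of both degree conditions. In an oriented graph `b`, being an
  -- out-neighbour of `v`, is no in-neighbour, so only `a` has to be avoided and in-degree 2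
  -- suffices; in general in-degree 3 avoids both.
  SecondInNeighbour : Set
  SecondInNeighbour = ∀ a v b → Arc (arcs D) a v → Arc (arcs D) v b →
                      ∃ λ u → Arc (arcs D) u v × u ≢ a × u ≢ b

  open DecMembership (_≟_ {n}) using (_∈?_)

  avoiding-in-neighbour : ∀ {k} → MinInDegreeAtLeast k D → ∀ v vs → length vs < k →
                          ∃ λ u → Arc (arcs D) u v × u ∉ vs
  avoiding-in-neighbour minDegree v vs short
    with any? (λ u → arc? (arcs D) u v ×-dec ¬? (u ∈? vs))
  ... | yes found = found
  ... | no  none  = contradiction
    (≤-trans (minDegree v) (unique⊆⇒length≤ (filter⁺ arcTo? (allFin⁺ n)) ⊆vs)) (<⇒≱ short)
    where
    arcTo? = λ u → arc? (arcs D) u v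

    ⊆vs : filter arcTo? (allFin n) ⊆ vs
    ⊆vs {u} u∈ = decidable-stable (u ∈? vs) λ u∉ →
      none (u , proj₂ (∈-filter⁻ arcTo? {xs = allFin n} u∈) , u∉)

  module _ (second : SecondInNeighbour) where

    private
      other? : ∀ a v b → Dec (∃ λ u → Arc (arcs D) u v × u ≢ a × u ≢ b)
      other? a v b = any? λ u → arc? (arcs D) u v ×-dec ¬? (u ≟ a) ×-dec ¬? (u ≟ b)

      other : Fin n → Fin n → Fin n → Fin n
      other a v b with other? a v b
      ... | yes (u , _) = u
      ... | no  _       = v

      other-spec : ∀ {a v b} → Arc (arcs D) a v → Arc (arcs D) v b →
                   Arc (arcs D) (other a v b) v × other a v b ≢ a × other a v b ≢ b
      other-spec {a} {v} {b} a→v v→b with other? a v b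
      ... | yes (_ , spec) = spec
      ... | no  none       = contradiction (second a v b a→v v→b) none

    -- As the bound is decidable, it suffices that a spanning arborescence with
    -- as many leaves as possible cannot fail to exist.
    order-bound : StronglyConnected D → n ≤ 4 * (ℓₛ D + 1) ^ 3
    order-bound connected = decidable-stable (n ≤? 4 * (ℓₛ D + 1) ^ 3) λ n≰ →
      -- A failing bound forces `n` to be positive, which provides a root to start from.
      unbounded n≰ (suc n) (+-identityʳ (suc n))
        (spanning-exists connected (fromℕ< (≤-trans (s≤s z≤n) (≰⇒> n≰))))
        ([] , [] , [] , z≤n)
      where
      -- Induction on `k`, the distance of `m` from `n + 1`: there are never `n + 1` distinct
      -- leaves, and if no spanning tree has `m + 1` leaves, then a tree with `m` leaves is maximal
      -- and yields the bound assumed to fail.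
      unbounded : ¬ n ≤ 4 * (ℓₛ D + 1) ^ 3 →
                  ∀ k {m} → k + m ≡ suc n → (T : Spanning) → ¬ HasLeaves T m
      unbounded n≰ zero refl T (L , unique , _ , n<L) = n≮n n (begin-strict
        n                   <⟨ n<L ⟩
        length L            ≤⟨ unique⊆⇒length≤ unique (λ {v} _ → ∈-allFin v) ⟩
        length (allFin n)   ≡⟨ length-tabulate {n = n} id ⟩
        n                   ∎)
        where open ≤-Reasoning
      unbounded n≰ (suc k) {m} k+m≡n T leaves = n≰ (≤-trans
        (Maximal.order≤ (loopless D refl) other other-spec maximal T leaves)
        (≤-trans (quadratic≤cubic m) (*-monoʳ-≤ 4 (^-monoˡ-≤ 3 (+-monoˡ-≤ 1 (hasLeaves≤ℓₛ D T leaves))))))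
        where
        maximal : LeavesAtMost m
        maximal W? A leaves′ = ≮⇒≥ λ m<k′ →
          let T′ , L , unique , leaf , k′≤ = spanning connected A W? leaves′
          in  unbounded n≰ k (trans (+-suc k m) k+m≡n) T′ (L , unique , leaf , ≤-trans m<k′ k′≤)

theorem4 : (n : ℕ) (D : Digraph n) → StronglyConnected D →
    ((IsOriented D → MinInDegreeAtLeast 2 D → n ≤ 4 * (ℓₛ D + 1) ^ 3) ×
     (MinInDegreeAtLeast 3 D → n ≤ 4 * (ℓₛ D + 1) ^ 3))
theorem4 n D connected =
  (λ oriented minDegree → order-bound D (λ a v b _ v→b →
     let u , u→v , u∉ = avoiding-in-neighbour D minDegree v (a ∷ []) (s≤s (s≤s z≤n))
     in  u , u→v , u∉ ∘ here , λ { refl → oriented u→v v→b }) connected) ,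
  (λ minDegree → order-bound D (λ a v b _ _ →
     let u , u→v , u∉ = avoiding-in-neighbour D minDegree v (a ∷ b ∷ []) (s≤s (s≤s (s≤s z≤n)))
     in  u , u→v , u∉ ∘ here , u∉ ∘ there ∘ here) connected)
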